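{- Let $\mathcal{A}$ be a finite set of $m$ alternatives and $\mathcal{R}=(R_1,\dots,R_n)$ a sequence of reflexive binary relations on $\mathcal{A}$. Construct the weighted directed graph $G$ whose nodes are a source $s$, a sink $t$, one node for each alternative $a\in\mathcal{A}$, and one node $v_{(a,b)}$ for each ordered pair $(a,b)$ of distinct alternatives, with the following arcs: for each ordered pair $(a,b)$ of distinct alternatives, an arc $s\to v_{(a,b)}$ of weight $N(a,b)$, an arc $v_{(a,b)}\to t$ of weight $N(b,a)$, and arcs $a\to v_{(a,b)}$ and $v_{(a,b)}\to a$ each of weight $L$, where $L>(mn)^5$; and for each unordered pair $\{a,b\}$ of distinct alternatives, arcs $a\to b$ and $b\to a$ each of weight $E(a,b)=E(b,a)$. An $s$-$t$ cut is a partition $(A,B)$ of the node set with $s\in A$, $t\in B$; its capacity is the total weight of arcs from $A$ to $B$; a minimum cut is one of minimum capacity. Then: (1) If $(A,B)$ is a minimum cut, then the dichotomous weak order given by the ordered partition $(A\cap\mathcal{A},\,B\cap\mathcal{A})$ of the alternatives has cost equal to $\mathrm{MP}(\mathcal{R},2\text{ - }\mathrm{WO})$. (2) If the dichotomous weak order given by $(A',B')$ has cost equal to $\mathrm{MP}(\mathcal{R},2\text{ - }\mathrm{WO})$, then $(A,B)$ is a minimum cut, where $A$ consists of $s$, the nodes of the alternatives in $A'$, and the nodes $v_{(x,y)}$ with $x\in A'$, and $B$ consists of all remaining nodes.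
   Context: For alternatives $a,b\in\mathcal{A}$, let $N(a,b)$ be the number of indices $i$ with $(a,b)\in R_i$ and $(b,a)\notin R_i$, and $E(a,b)$ the number of indices $i$ with $(a,b)\in R_i$ and $(b,a)\in R_i$. A dichotomous weak order on $\mathcal{A}$ is given by an ordered partition $(A_1,A_2)$ of $\mathcal{A}$ (disjoint, union $\mathcal{A}$): every alternative of $A_1$ is strictly preferred to every alternative of $A_2$ and alternatives in the same part are tied. Its cost is $$\sum_{a\in A_1,\ b\in A_2}\big(2N(b,a)+E(b,a)\big)+\sum_{\{a,b\}:\ a\neq b,\ a,b\text{ in the same part}}\big(N(a,b)+N(b,a)\big),$$ the second sum over unordered pairs of distinct alternatives; $\mathrm{MP}(\mathcal{R},2\text{ - }\mathrm{WO})$ denotes the minimum cost over all dichotomous weak orders on $\mathcal{A}$.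
   Formalization: The weight L is taken to be a rational number greater than (mn)^5 rather than an arbitrary real one, and the relations R_i come with a decision procedure so that N and E can be counted. -}

module Defs where

open import Data.Bool using (Bool; true; false; _∧_; not)
import Data.Bool as Bool
open import Data.Fin using (Fin; _<?_)
import Data.Fin as Fin
open import Data.Fin.Subset using (Subset; inside; outside; ∁; ⊥)
open import Data.Fin.Subset.Properties using (_∈?_)
open import Data.Integer using (+_)
open import Data.List using (List; []; _∷_; _++_; map; concatMap; mapMaybe; filter; filterᵇ; foldr; length; allFin; cartesianProduct)
open import Data.List.Extrema.Nat using (min; min≤xs; argmin-sel)
open import Data.List.Membership.Propositional using (_∈_)
open import Data.List.Membership.Propositional.Properties using (∈-map⁺; ∈-map⁻; ∈-++⁺ˡ; ∈-++⁺ʳ)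
open import Data.List.Relation.Unary.All using () renaming (lookup to All-lookup)
open import Data.List.Relation.Unary.Any using (here)
import Data.Maybe as Maybe
open import Data.Nat using (ℕ; zero; suc; _≤_) renaming (_+_ to _+ℕ_; _*_ to _*ℕ_)
open import Data.Nat.ListAction using (sum)
open import Data.Product using (∃; ∃₂; _×_; _,_)
open import Data.Rational using (ℚ; 0ℚ; _/_) renaming (_+_ to _+ℚ_; _≤_ to _≤ℚ_)
open import Data.Sum using (inj₁; inj₂)
open import Data.Vec using ([]; _∷_; lookup; tabulate)
open import Function using (id)
open import Level using (Level) renaming (suc to lsuc)
open import Relation.Binary using (Rel; Decidable; Reflexive)
open import Relation.Binary.PropositionalEquality using (_≡_; _≢_; refl; sym)
open import Relation.Nullary using (¬?; _×-dec_; dec⇒maybe)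

-- The alternatives are Fin m.  The relations are decidable because N and E
-- count the indices at which they hold.
record Profile (n m : ℕ) (ℓ : Level) : Set (lsuc ℓ) where
  field
    R         : Fin n → Rel (Fin m) ℓ
    R?        : ∀ i → Decidable (R i)
    reflexive : ∀ i → Reflexive (R i)

pairs : ∀ m → List (Fin m × Fin m)
pairs m = cartesianProduct (allFin m) (allFin m)

-- An unordered pair {a , b} of distinct alternatives is listed once, as (a , b)
-- with a < b.
unorderedPairs : ∀ m → List (Fin m × Fin m)
unorderedPairs m = filter (λ (a , b) → a <? b) (pairs m)

distinctPairs : ∀ m → List (∃₂ λ (a b : Fin m) → a ≢ b)
distinctPairs m =
  mapMaybe (λ (a , b) → Maybe.map (λ a≢b → a , b , a≢b) (dec⇒maybe (¬? (a Fin.≟ b))))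
           (pairs m)

subsets : ∀ m → List (Subset m)
subsets zero    = [] ∷ []
subsets (suc m) = map (inside ∷_) (subsets m) ++ map (outside ∷_) (subsets m)

∈-subsets : ∀ {m} (p : Subset m) → p ∈ subsets m
∈-subsets []          = here refl
∈-subsets (true ∷ p)  = ∈-++⁺ˡ (∈-map⁺ (inside ∷_) (∈-subsets p))
∈-subsets (false ∷ p) = ∈-++⁺ʳ (map (inside ∷_) (subsets _)) (∈-map⁺ (outside ∷_) (∈-subsets p))

module _ {n m : ℕ} {ℓ : Level} (P : Profile n m ℓ) where
  open Profile P

  N : Fin m → Fin m → ℕ
  N a b = length (filter (λ i → R? i a b ×-dec ¬? (R? i b a)) (allFin n))

  E : Fin m → Fin m → ℕ
  E a b = length (filter (λ i → R? i a b ×-dec R? i b a) (allFin n))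

  -- A dichotomous weak order (A₁ , A₂) is represented by A₁, with A₂ = ∁ A₁;
  -- either part may be empty.
  cost : Subset m → ℕ
  cost A₁ =
    sum (map (λ (a , b) → 2 *ℕ N b a +ℕ E b a)
             (filter (λ (a , b) → (a ∈? A₁) ×-dec (b ∈? ∁ A₁)) (pairs m)))
    +ℕ
    sum (map (λ (a , b) → N a b +ℕ N b a)
             (filter (λ (a , b) → lookup A₁ a Bool.≟ lookup A₁ b) (unorderedPairs m)))

  -- min x xs is the minimum of x and the members of xs; cost ⊥, the cost of
  -- (∅ , all alternatives), is itself one of the values minimised over.
  MP-2WO : ℕ
  MP-2WO = min (cost ⊥) (map cost (subsets m))

  MP-2WO-lower : ∀ p → MP-2WO ≤ cost p
  MP-2WO-lower p =
    All-lookup (min≤xs (cost ⊥) (map cost (subsets m))) (∈-map⁺ cost (∈-subsets p))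

  MP-2WO-attained : ∃ λ p → cost p ≡ MP-2WO
  MP-2WO-attained with argmin-sel id (cost ⊥) (map cost (subsets m))
  ... | inj₁ eq = ⊥ , sym eq
  ... | inj₂ ∈xs with ∈-map⁻ cost ∈xs
  ...   | p , _ , eq = p , sym eq

record Arc (V : Set) : Set where
  constructor arc
  field
    from to : V
    weight  : ℚ

-- A weighted directed graph on the node set V is given by its list of arcs.
Digraph : Set → Set
Digraph V = List (Arc V)

-- A partition (A , B) of V is represented by the indicator function of A.
Partition : Set → Set
Partition V = V → Bool

module _ {V : Set} where
  open Arc

  capacity : Digraph V → Partition V → ℚ
  capacity G A = foldr _+ℚ_ 0ℚ (map weight (filterᵇ (λ e → A (from e) ∧ not (A (to e))) G))

  IsCut : V → V → Partition V → Set
  IsCut s t A = A s ≡ true × A t ≡ false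

  IsMinimumCut : Digraph V → V → V → Partition V → Set
  IsMinimumCut G s t A =
    IsCut s t A × (∀ A′ → IsCut s t A′ → capacity G A ≤ℚ capacity G A′)

-- All proofs of a ≢ b are definitionally equal, so there is exactly one node
-- pair a b _ for each ordered pair of distinct alternatives.
data Node (m : ℕ) : Set where
  source sink : Node m
  alt         : Fin m → Node m
  pair        : (a b : Fin m) → a ≢ b → Node m

fromℕ : ℕ → ℚ
fromℕ k = + k / 1

cutGraph : ∀ {n m ℓ} → Profile n m ℓ → ℚ → Digraph (Node m)
cutGraph {m = m} P L =
  concatMap
    (λ (a , b , a≢b) →
        arc source         (pair a b a≢b) (fromℕ (N P a b))
      ∷ arc (pair a b a≢b) sink           (fromℕ (N P b a))
      ∷ arc (alt a)        (pair a b a≢b) L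
      ∷ arc (pair a b a≢b) (alt a)        L
      ∷ [])
    (distinctPairs m)
  ++
  concatMap
    (λ (a , b) →
        arc (alt a) (alt b) (fromℕ (E P a b))
      ∷ arc (alt b) (alt a) (fromℕ (E P a b))
      ∷ [])
    (unorderedPairs m)

-- A ↦ A ∩ 𝒜
alternatives : ∀ {m} → Partition (Node m) → Subset m
alternatives A = tabulate (λ a → A (alt a))

inducedCut : ∀ {m} → Subset m → Partition (Node m)
inducedCut A′ source       = true
inducedCut A′ sink         = false
inducedCut A′ (alt a)      = lookup A′ a
inducedCut A′ (pair x y _) = lookup A′ x

{-# OPTIONS --safe #-}
module Submission where

-- Replacing each pair node v₍ₐ,ᵦ₎ of a cut by the side of a never increases the
-- capacity: a disagreement cuts an arc of weight L, while it saves at most one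
-- weight N(·,·) ≤ n ≤ (mn)⁵ < L.  So inducedCut (alternatives A) is no worse
-- than A.  The capacity of inducedCut S is exactly cost S, as one sees by
-- grouping all arcs by the unordered pair {a , b} they belong to: if a and b are
-- on the same side, v₍ₐ,ᵦ₎ and v₍ᵦ,ₐ₎ contribute N(a,b) + N(b,a); if a is in S
-- and b is not, both contribute N(b,a), and the arc a → b adds E(a,b).

open import Defs
open import Data.Bool using (true; false; if_then_else_; _∧_; not; _xor_)
import Data.Bool as Bool
open import Data.Bool.Properties using (if-float)
open import Data.Fin using (Fin; _<?_)
import Data.Fin as Fin
import Data.Fin.Properties as Fin
open import Data.Fin.Subset using (Subset; ∁; _∈_)
open import Data.Fin.Subset.Properties using (_∈?_; x∈∁p⇒x∉p)
import Data.Integer as ℤ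
import Data.Integer.Properties as ℤ
open import Data.List using (List; []; _∷_; _++_; map; concatMap; filter; foldr; length; allFin; mapMaybe; cartesianProduct)
open import Data.List.Properties using (map-cong; map-++; map-∘; length-filter; length-tabulate; filter-≐)
open import Data.Maybe using (Maybe)
import Data.Maybe as Maybe
open import Data.Nat using (ℕ; zero; suc; NonZero; _+_; _*_; _^_; z≤n)
import Data.Nat as ℕ
open import Data.Nat.ListAction using (sum)
open import Data.Nat.ListAction.Properties using (sum-++)
open import Data.Nat.Properties using (+-comm; +-identityʳ; m≤m*n; m≤n*m; m^n≢0; m*n≢0; +-commutativeSemigroup)
import Data.Nat.Properties as ℕ
open import Algebra.Properties.CommutativeSemigroup +-commutativeSemigroup using (interchange)
open import Data.Product using (_×_; _,_; ∃₂; swap)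
open import Data.Rational using (ℚ; 0ℚ; _<_; _≤_; toℚᵘ) renaming (_+_ to _+ℚ_)
import Data.Rational.Properties as ℚ
open import Data.Rational.Unnormalised using (mkℚᵘ; *≡*; *≤*)
import Data.Rational.Unnormalised as ℚᵘ
import Data.Rational.Unnormalised.Properties as ℚᵘ
open import Data.Vec using ([]; _∷_; lookup)
open import Data.Vec.Properties using (lookup∘tabulate; lookup-map)
open import Function using (_∘_)
open import Level using (Level)
open import Relation.Binary using (tri<; tri≈; tri>)
open import Relation.Binary.PropositionalEquality using (_≡_; _≢_; refl; sym; trans; cong; cong₂; subst; module ≡-Reasoning)
open import Relation.Nullary using (¬_; yes; no; ¬?; does; dec⇒maybe; _×-dec_)
open import Relation.Nullary.Decidable using (dec-true; dec-false)
open import Relation.Unary using (Pred) renaming (Decidable to Decidable₁)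

private
  variable
    a p : Level
    X Y : Set a
    V : Set

-- Finite sums over lists, and over ordered versus unordered pairs.

∑ : (X → ℕ) → List X → ℕ
∑ f xs = sum (map f xs)

∑-cong : ∀ {f g : X → ℕ} → (∀ x → f x ≡ g x) → ∀ xs → ∑ f xs ≡ ∑ g xs
∑-cong f≗g xs = cong sum (map-cong f≗g xs)

∑-+ : ∀ (f g : X → ℕ) xs → ∑ (λ x → f x + g x) xs ≡ ∑ f xs + ∑ g xs
∑-+ f g []       = refl
∑-+ f g (x ∷ xs) = trans (cong (f x + g x +_) (∑-+ f g xs)) (interchange (f x) (g x) _ _)

∑-0 : ∀ (xs : List X) → ∑ (λ _ → 0) xs ≡ 0
∑-0 []       = refl
∑-0 (_ ∷ xs) = ∑-0 xs

∑-comm : ∀ (f : X → Y → ℕ) xs ys → ∑ (λ x → ∑ (f x) ys) xs ≡ ∑ (λ y → ∑ (λ x → f x y) xs) ys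
∑-comm f []       ys = sym (∑-0 ys)
∑-comm f (x ∷ xs) ys = trans (cong (∑ (f x) ys +_) (∑-comm f xs ys)) (sym (∑-+ (f x) _ ys))

∑-filter : ∀ {P : Pred X p} (P? : Decidable₁ P) (f : X → ℕ) xs →
  ∑ f (filter P? xs) ≡ ∑ (λ x → if does (P? x) then f x else 0) xs
∑-filter P? f []       = refl
∑-filter P? f (x ∷ xs) with does (P? x)
... | true  = cong (f x +_) (∑-filter P? f xs)
... | false = ∑-filter P? f xs

∑-cartesianProduct : ∀ (f : X × Y → ℕ) xs ys →
  ∑ f (cartesianProduct xs ys) ≡ ∑ (λ x → ∑ (λ y → f (x , y)) ys) xs
∑-cartesianProduct f []       ys = refl
∑-cartesianProduct f (x ∷ xs) ys = begin
  sum (map f (map (x ,_) ys ++ cartesianProduct xs ys))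
    ≡⟨ cong sum (map-++ f (map (x ,_) ys) _) ⟩
  sum (map f (map (x ,_) ys) ++ map f (cartesianProduct xs ys))
    ≡⟨ sum-++ (map f (map (x ,_) ys)) _ ⟩
  ∑ f (map (x ,_) ys) + ∑ f (cartesianProduct xs ys)
    ≡⟨ cong₂ _+_ (cong sum (sym (map-∘ ys))) (∑-cartesianProduct f xs ys) ⟩
  ∑ (λ x → ∑ (λ y → f (x , y)) ys) (x ∷ xs) ∎
  where open ≡-Reasoning

∑-pairs-swap : ∀ m (f : Fin m × Fin m → ℕ) → ∑ f (pairs m) ≡ ∑ (f ∘ swap) (pairs m)
∑-pairs-swap m f = begin
  ∑ f (pairs m)                                        ≡⟨ ∑-cartesianProduct f (allFin m) (allFin m) ⟩
  ∑ (λ x → ∑ (λ y → f (x , y)) (allFin m)) (allFin m)  ≡⟨ ∑-comm (λ x y → f (x , y)) (allFin m) (allFin m) ⟩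
  ∑ (λ y → ∑ (λ x → f (x , y)) (allFin m)) (allFin m)  ≡⟨ ∑-cartesianProduct (f ∘ swap) (allFin m) (allFin m) ⟨
  ∑ (f ∘ swap) (pairs m)                               ∎
  where open ≡-Reasoning

-- By trichotomy each `(i , j)` is increasing, decreasing or diagonal; `up` keeps the increasing
-- ones. Allowing `f` and `g` to differ on the diagonal lets `f` carry a guard that vanishes there
-- while `g` is the bare formula.
∑-offDiagonal : ∀ m (f g : Fin m × Fin m → ℕ) →
  (∀ i → f (i , i) ≡ 0) → (∀ {i j} → i ≢ j → f (i , j) ≡ g (i , j)) →
  ∑ f (pairs m) ≡ ∑ (λ q → g q + g (swap q)) (unorderedPairs m)
∑-offDiagonal m f g f-diag f≡g = begin
  ∑ f (pairs m)                                        ≡⟨ ∑-cong split (pairs m) ⟩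
  ∑ (λ q → up g q + up (g ∘ swap) (swap q)) (pairs m)  ≡⟨ ∑-+ (up g) (up (g ∘ swap) ∘ swap) (pairs m) ⟩
  ∑ (up g) (pairs m) + ∑ (up (g ∘ swap) ∘ swap) (pairs m)
    -- Swapping coordinates turns the decreasing half into a sum over increasing pairs.
    ≡⟨ cong (∑ (up g) (pairs m) +_) (∑-pairs-swap m (up (g ∘ swap))) ⟨
  ∑ (up g) (pairs m) + ∑ (up (g ∘ swap)) (pairs m)
    ≡⟨ cong₂ _+_ (∑-filter _ g (pairs m)) (∑-filter _ (g ∘ swap) (pairs m)) ⟨
  ∑ g (unorderedPairs m) + ∑ (g ∘ swap) (unorderedPairs m)
    ≡⟨ ∑-+ g (g ∘ swap) (unorderedPairs m) ⟨
  ∑ (λ q → g q + g (swap q)) (unorderedPairs m)        ∎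
  where
  open ≡-Reasoning

  up : (Fin m × Fin m → ℕ) → Fin m × Fin m → ℕ
  up h (i , j) = if does (i <? j) then h (i , j) else 0

  split : ∀ q → f q ≡ up g q + up (g ∘ swap) (swap q)
  split (i , j) with Fin.<-cmp i j
  ... | tri< i<j i≢j j≮i rewrite dec-true (i <? j) i<j | dec-false (j <? i) j≮i = trans (f≡g i≢j) (sym (+-identityʳ _))
  ... | tri> i≮j i≢j j<i rewrite dec-false (i <? j) i≮j | dec-true (j <? i) j<i = f≡g i≢j
  ... | tri≈ i≮i refl _ rewrite dec-false (i <? i) i≮i = f-diag i

∑-distinctPairs : ∀ m (f : Fin m × Fin m → ℕ) →
  ∑ (λ (i , j , _) → f (i , j)) (distinctPairs m) ≡ ∑ (λ q → f q + f (swap q)) (unorderedPairs m)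
∑-distinctPairs m f = trans (onPairs (pairs m))
  (∑-offDiagonal m _ f
    (λ i → cong (if_then 0 else f (i , i)) (dec-true (i Fin.≟ i) refl))
    (λ {i} {j} i≢j → cong (if_then 0 else f (i , j)) (dec-false (i Fin.≟ j) i≢j)))
  where
  -- This repeats the function inside `distinctPairs`, so that `onPairs` can be stated for an
  -- arbitrary list and proved by induction.
  distinct : Fin m × Fin m → Maybe (∃₂ λ (i j : Fin m) → i ≢ j)
  distinct (i , j) = Maybe.map (λ i≢j → i , j , i≢j) (dec⇒maybe (¬? (i Fin.≟ j)))

  onPairs : ∀ qs → ∑ (λ ((i , j , _) : ∃₂ λ (i j : Fin m) → i ≢ j) → f (i , j)) (mapMaybe distinct qs)
    ≡ ∑ (λ (i , j) → if does (i Fin.≟ j) then 0 else f (i , j)) qs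
  onPairs []             = refl
  onPairs ((i , j) ∷ qs) with i Fin.≟ j
  ... | yes _ = onPairs qs
  ... | no  _ = cong (f (i , j) +_) (onPairs qs)

-- Meant for the first sum of `cost`: no alternative lies in both parts, so the filter already
-- excludes the diagonal. The guard stays in the summand, since it may hold for only one order of a
-- pair.
∑-filter-offDiagonal : ∀ m (f : Fin m × Fin m → ℕ) {P : Pred (Fin m × Fin m) p} (P? : Decidable₁ P) →
  (∀ i → ¬ P (i , i)) →
  ∑ f (filter P? (pairs m)) ≡
  ∑ (λ q → (if does (P? q) then f q else 0) + (if does (P? (swap q)) then f (swap q) else 0)) (unorderedPairs m)
∑-filter-offDiagonal m f P? ¬diag = trans (∑-filter P? f (pairs m))
  (∑-offDiagonal m _ _
    (λ i → cong (if_then f (i , i) else 0) (dec-false (P? (i , i)) (¬diag i)))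
    (λ _ → refl))

-- The embedding of the naturals in the rationals.

-- `_/_` normalises by a gcd, so `fromℕ k` does not compute for a variable `k`. Unnormalised
-- fractions over 1 do; the `0` in `mkℚᵘ` is the denominator minus one.
fromℕ-toℚᵘ : ∀ k → toℚᵘ (fromℕ k) ℚᵘ.≃ mkℚᵘ (ℤ.+ k) 0
fromℕ-toℚᵘ k = ℚ.toℚᵘ-fromℚᵘ (mkℚᵘ (ℤ.+ k) 0)

fromℕ-+ : ∀ j k → fromℕ (j + k) ≡ fromℕ j +ℚ fromℕ k
fromℕ-+ j k = ℚ.toℚᵘ-injective (begin-equality
  toℚᵘ (fromℕ (j + k))                        ≃⟨ fromℕ-toℚᵘ (j + k) ⟩
  mkℚᵘ (ℤ.+ (j + k)) 0
    ≃⟨ *≡* (cong (ℤ._* ℤ.1ℤ) (cong₂ ℤ._+_ (ℤ.*-identityʳ (ℤ.+ j)) (ℤ.*-identityʳ (ℤ.+ k)))) ⟨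
  mkℚᵘ (ℤ.+ j) 0 ℚᵘ.+ mkℚᵘ (ℤ.+ k) 0          ≃⟨ ℚᵘ.+-cong (fromℕ-toℚᵘ j) (fromℕ-toℚᵘ k) ⟨
  toℚᵘ (fromℕ j) ℚᵘ.+ toℚᵘ (fromℕ k)          ≃⟨ ℚ.toℚᵘ-homo-+ (fromℕ j) (fromℕ k) ⟨
  toℚᵘ (fromℕ j +ℚ fromℕ k)                   ∎)
  where open ℚᵘ.≤-Reasoning

fromℕ-mono-≤ : ∀ j k → j ℕ.≤ k → fromℕ j ≤ fromℕ k
fromℕ-mono-≤ j k j≤k = ℚ.toℚᵘ-cancel-≤ (begin
  toℚᵘ (fromℕ j)   ≃⟨ fromℕ-toℚᵘ j ⟩
  mkℚᵘ (ℤ.+ j) 0   ≤⟨ *≤* (ℤ.*-monoʳ-≤-nonNeg ℤ.1ℤ (ℤ.+≤+ j≤k)) ⟩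
  mkℚᵘ (ℤ.+ k) 0   ≃⟨ fromℕ-toℚᵘ k ⟨
  toℚᵘ (fromℕ k)   ∎)
  where open ℚᵘ.≤-Reasoning

fromℕ-cancel-≤ : ∀ j k → fromℕ j ≤ fromℕ k → j ℕ.≤ k
fromℕ-cancel-≤ j k j≤k = ℤ.drop‿+≤+ (ℤ.*-cancelʳ-≤-pos (ℤ.+ j) (ℤ.+ k) ℤ.1ℤ (ℚᵘ.drop-*≤* (begin
  mkℚᵘ (ℤ.+ j) 0   ≃⟨ fromℕ-toℚᵘ j ⟨
  toℚᵘ (fromℕ j)   ≤⟨ ℚ.toℚᵘ-mono-≤ j≤k ⟩
  toℚᵘ (fromℕ k)   ≃⟨ fromℕ-toℚᵘ k ⟩
  mkℚᵘ (ℤ.+ k) 0   ∎)))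
  where open ℚᵘ.≤-Reasoning

-- Capacities of concatenated digraphs.

-- Unlike filterᵇ, the nested conditionals expose every arc of a concrete
-- digraph at once, so that case distinctions on A can see all of them.
capacity-foldr : ∀ (G : Digraph V) A → capacity G A ≡
  foldr (λ (arc u v w) r → if A u ∧ not (A v) then w +ℚ r else r) 0ℚ G
capacity-foldr []              A = refl
capacity-foldr (arc u v w ∷ G) A with A u ∧ not (A v)
... | true  = cong (w +ℚ_) (capacity-foldr G A)
... | false = capacity-foldr G A

capacity-++ : ∀ (G H : Digraph V) A → capacity (G ++ H) A ≡ capacity G A +ℚ capacity H A
capacity-++ []              H A = sym (ℚ.+-identityˡ _)
capacity-++ (arc u v w ∷ G) H A with A u ∧ not (A v)
... | true  = trans (cong (w +ℚ_) (capacity-++ G H A)) (sym (ℚ.+-assoc w _ _))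
... | false = capacity-++ G H A

capacity-concatMap-mono-≤ : ∀ (A B : Partition V) (f : X → Digraph V) →
  (∀ x → capacity (f x) A ≤ capacity (f x) B) →
  ∀ xs → capacity (concatMap f xs) A ≤ capacity (concatMap f xs) B
capacity-concatMap-mono-≤ A B f f≤ []       = ℚ.≤-refl
capacity-concatMap-mono-≤ A B f f≤ (x ∷ xs)
  rewrite capacity-++ (f x) (concatMap f xs) A | capacity-++ (f x) (concatMap f xs) B
  = ℚ.+-mono-≤ (f≤ x) (capacity-concatMap-mono-≤ A B f f≤ xs)

capacity-concatMap-fromℕ : ∀ (A : Partition V) (f : X → Digraph V) (g : X → ℕ) →
  (∀ x → capacity (f x) A ≡ fromℕ (g x)) →
  ∀ xs → capacity (concatMap f xs) A ≡ fromℕ (∑ g xs)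
capacity-concatMap-fromℕ A f g f≡g []       = refl
capacity-concatMap-fromℕ A f g f≡g (x ∷ xs) = begin
  capacity (f x ++ concatMap f xs) A               ≡⟨ capacity-++ (f x) (concatMap f xs) A ⟩
  capacity (f x) A +ℚ capacity (concatMap f xs) A  ≡⟨ cong₂ _+ℚ_ (f≡g x) (capacity-concatMap-fromℕ A f g f≡g xs) ⟩
  fromℕ (g x) +ℚ fromℕ (∑ g xs)                    ≡⟨ fromℕ-+ (g x) (∑ g xs) ⟨
  fromℕ (g x + ∑ g xs)                             ∎
  where open ≡-Reasoning

-- The arcs belonging to a single pair.

-- Here `x` stands for the first alternative and `v` for the pair node. With arbitrary nodes, `A x`
-- and `A v` are plain booleans to split on.
pairGadget : (s t x v : V) (w₁ w₂ L : ℚ) → Digraph V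
pairGadget s t x v w₁ w₂ L = arc s v w₁ ∷ arc v t w₂ ∷ arc x v L ∷ arc v x L ∷ []

tieGadget : (x y : V) (w : ℚ) → Digraph V
tieGadget x y w = arc x y w ∷ arc y x w ∷ []

-- Since `v` sides with `x`, neither arc of weight `L` crosses, and exactly one of `s → v` and
-- `v → t` does.
capacity-pairGadget : ∀ (s t x v : V) w₁ w₂ L A → IsCut s t A → A v ≡ A x →
  capacity (pairGadget s t x v w₁ w₂ L) A ≡ (if A x then w₂ else w₁)
capacity-pairGadget s t x v w₁ w₂ L A (As , At) Av≡Ax
  rewrite capacity-foldr (pairGadget s t x v w₁ w₂ L) A | As | At | Av≡Ax with A x
... | true  = ℚ.+-identityʳ w₂
... | false = ℚ.+-identityʳ w₁

-- The right-hand side is what the fold of `capacity-foldr` leaves when one arc at `s` or `t` and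
-- one arc of weight `L` cross.
w≤u+[L+0] : ∀ {u w L} → 0ℚ ≤ u → w ≤ L → w ≤ u +ℚ (L +ℚ 0ℚ)
w≤u+[L+0] {u} {w} {L} 0≤u w≤L = begin
  w                ≡⟨ ℚ.+-identityˡ w ⟨
  0ℚ +ℚ w          ≤⟨ ℚ.+-mono-≤ 0≤u w≤L ⟩
  u +ℚ L           ≡⟨ cong (u +ℚ_) (ℚ.+-identityʳ L) ⟨
  u +ℚ (L +ℚ 0ℚ)   ∎
  where open ℚ.≤-Reasoning

-- If v and x disagree, L is cut, and it exceeds whatever the disagreement can save.
capacity-pairGadget-≥ : ∀ (s t x v : V) w₁ w₂ L A → IsCut s t A →
  0ℚ ≤ w₁ → 0ℚ ≤ w₂ → w₁ ≤ L → w₂ ≤ L →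
  (if A x then w₂ else w₁) ≤ capacity (pairGadget s t x v w₁ w₂ L) A
capacity-pairGadget-≥ s t x v w₁ w₂ L A (As , At) 0≤w₁ 0≤w₂ w₁≤L w₂≤L
  rewrite capacity-foldr (pairGadget s t x v w₁ w₂ L) A | As | At with A x | A v
... | true  | true  = ℚ.≤-reflexive (sym (ℚ.+-identityʳ w₂))
... | false | false = ℚ.≤-reflexive (sym (ℚ.+-identityʳ w₁))
... | true  | false = w≤u+[L+0] 0≤w₁ w₂≤L
... | false | true  = w≤u+[L+0] 0≤w₂ w₁≤L

capacity-tieGadget : ∀ (x y : V) w A → capacity (tieGadget x y w) A ≡ (if A x xor A y then w else 0ℚ)
capacity-tieGadget x y w A rewrite capacity-foldr (tieGadget x y w) A with A x | A y
... | true  | true  = refl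
... | true  | false = ℚ.+-identityʳ w
... | false | true  = ℚ.+-identityʳ w
... | false | false = refl

-- `cost` tests membership with `∈?` whereas `inducedCut` uses `lookup`; this brings both to the
-- same boolean.
does-∈? : ∀ {m} (i : Fin m) (S : Subset m) → does (i ∈? S) ≡ lookup S i
does-∈? Fin.zero    (true  ∷ S) = refl
does-∈? Fin.zero    (false ∷ S) = refl
does-∈? (Fin.suc i) (_     ∷ S) = does-∈? i S

-- Bounds and symmetry for a profile, and the decomposition of its cut graph.

module _ {n m : ℕ} {ℓ : Level} (P : Profile n m ℓ) where
  N≤n : ∀ i j → N P i j ℕ.≤ n
  N≤n i j = subst (N P i j ℕ.≤_) (length-tabulate {n = n} (λ k → k)) (length-filter _ (allFin n))

  -- The tie arcs carry `E P i j` only for `i < j`, while `cost` may ask for `E P j i`.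
  E-sym : ∀ i j → E P i j ≡ E P j i
  E-sym i j = cong length (filter-≐ _ _ (swap , swap) (allFin n))

  -- The alternative `i` witnesses that `m` is nonzero, whence `n ≤ mn ≤ (mn)⁵`.
  N≤[mn]⁵ : ∀ i j → N P i j ℕ.≤ (m * n) ^ 5
  N≤[mn]⁵ i j = ℕ.≤-trans (N≤n i j) (n≤[mn]⁵ {{Fin.nonZeroIndex i}})
    where
    -- `n` is quantified anew to be split on: when it is positive, the remaining factor `(mn)⁴` is
    -- nonzero.
    n≤[mn]⁵ : ∀ {n} {{_ : NonZero m}} → n ℕ.≤ (m * n) ^ 5
    n≤[mn]⁵ {zero}      = z≤n
    n≤[mn]⁵ {n@(suc _)} = ℕ.≤-trans (m≤n*m n m) (m≤m*n (m * n) ((m * n) ^ 4) {{m^n≢0 (m * n) 4 {{m*n≢0 m n}}}})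

  module _ (L : ℚ) where

    pairArcs : ∃₂ (λ (i j : Fin m) → i ≢ j) → Digraph (Node m)
    pairArcs (i , j , i≢j) = pairGadget source sink (alt i) (pair i j i≢j) (fromℕ (N P i j)) (fromℕ (N P j i)) L

    altArcs : Fin m × Fin m → Digraph (Node m)
    altArcs (i , j) = tieGadget (alt i) (alt j) (fromℕ (E P i j))

    capacity-cutGraph : ∀ A → capacity (cutGraph P L) A ≡
      capacity (concatMap pairArcs (distinctPairs m)) A +ℚ capacity (concatMap altArcs (unorderedPairs m)) A
    capacity-cutGraph = capacity-++ (concatMap pairArcs (distinctPairs m)) (concatMap altArcs (unorderedPairs m))

    -- Passing to the induced cut does not increase capacity.

    -- Both cuts put `alt i` on the same side, and the induced cut attains the lower bound of
    -- `capacity-pairGadget-≥` for that side.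
    pairArcs-induced-≤ : fromℕ ((m * n) ^ 5) < L → ∀ A → IsCut source sink A → ∀ q →
      capacity (pairArcs q) (inducedCut (alternatives A)) ≤ capacity (pairArcs q) A
    pairArcs-induced-≤ L-large A cut q@(i , j , i≢j) = begin
      capacity (pairArcs q) (inducedCut (alternatives A))
        ≡⟨ capacity-pairGadget source sink (alt i) (pair i j i≢j) Nᵢⱼ Nⱼᵢ L
             -- By definition `inducedCut` separates source from sink and sends `pair i j` to the
             -- side of `alt i`.
             (inducedCut (alternatives A)) (refl , refl) refl ⟩
      (if lookup (alternatives A) i then Nⱼᵢ else Nᵢⱼ)
        ≡⟨ cong (if_then Nⱼᵢ else Nᵢⱼ) (lookup∘tabulate (A ∘ alt) i) ⟩
      (if A (alt i) then Nⱼᵢ else Nᵢⱼ)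
        ≤⟨ capacity-pairGadget-≥ source sink (alt i) (pair i j i≢j) Nᵢⱼ Nⱼᵢ L A cut
             (0≤N i j) (0≤N j i) (N≤L i j) (N≤L j i) ⟩
      capacity (pairArcs q) A ∎
      where
      open ℚ.≤-Reasoning

      Nᵢⱼ Nⱼᵢ : ℚ
      Nᵢⱼ = fromℕ (N P i j)
      Nⱼᵢ = fromℕ (N P j i)

      0≤N : ∀ i j → 0ℚ ≤ fromℕ (N P i j)
      0≤N i j = fromℕ-mono-≤ 0 (N P i j) z≤n

      N≤L : ∀ i j → fromℕ (N P i j) ≤ L
      N≤L i j = ℚ.≤-trans (fromℕ-mono-≤ (N P i j) ((m * n) ^ 5) (N≤[mn]⁵ i j)) (ℚ.<⇒≤ L-large)

    -- Tie arcs join alternatives only, and these keep their sides.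
    altArcs-induced : ∀ A q → capacity (altArcs q) (inducedCut (alternatives A)) ≡ capacity (altArcs q) A
    altArcs-induced A (i , j) = begin
      capacity (altArcs (i , j)) (inducedCut (alternatives A))
        ≡⟨ capacity-tieGadget (alt i) (alt j) Eᵢⱼ (inducedCut (alternatives A)) ⟩
      (if lookup (alternatives A) i xor lookup (alternatives A) j then Eᵢⱼ else 0ℚ)
        ≡⟨ cong₂ (λ x y → if x xor y then Eᵢⱼ else 0ℚ) (lookup∘tabulate (A ∘ alt) i) (lookup∘tabulate (A ∘ alt) j) ⟩
      (if A (alt i) xor A (alt j) then Eᵢⱼ else 0ℚ)
        ≡⟨ capacity-tieGadget (alt i) (alt j) Eᵢⱼ A ⟨
      capacity (altArcs (i , j)) A ∎
      where
      open ≡-Reasoning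

      Eᵢⱼ : ℚ
      Eᵢⱼ = fromℕ (E P i j)

    capacity-induced-≤ : fromℕ ((m * n) ^ 5) < L → ∀ A → IsCut source sink A →
      capacity (cutGraph P L) (inducedCut (alternatives A)) ≤ capacity (cutGraph P L) A
    capacity-induced-≤ L-large A cut = begin
      capacity (cutGraph P L) (inducedCut (alternatives A))
        ≡⟨ capacity-cutGraph (inducedCut (alternatives A)) ⟩
      capacity (concatMap pairArcs (distinctPairs m)) (inducedCut (alternatives A))
        +ℚ capacity (concatMap altArcs (unorderedPairs m)) (inducedCut (alternatives A))
        ≤⟨ ℚ.+-mono-≤
             (capacity-concatMap-mono-≤ (inducedCut (alternatives A)) A pairArcs
               (pairArcs-induced-≤ L-large A cut) (distinctPairs m))
             (capacity-concatMap-mono-≤ (inducedCut (alternatives A)) A altArcs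
               (λ q → ℚ.≤-reflexive (altArcs-induced A q)) (unorderedPairs m)) ⟩
      capacity (concatMap pairArcs (distinctPairs m)) A +ℚ capacity (concatMap altArcs (unorderedPairs m)) A
        ≡⟨ capacity-cutGraph A ⟨
      capacity (cutGraph P L) A ∎
      where open ℚ.≤-Reasoning

    -- The capacity of an induced cut is the cost of its order.

    module _ (S : Subset m) where

      pairCost : Fin m × Fin m → ℕ
      pairCost (i , j) = if lookup S i then N P j i else N P i j

      pairNodeCost : (∃₂ λ (i j : Fin m) → i ≢ j) → ℕ
      pairNodeCost (i , j , _) = pairCost (i , j)

      tieCost : Fin m × Fin m → ℕ
      tieCost (i , j) = if lookup S i xor lookup S j then E P i j else 0

      pairArcs-capacity : ∀ q → capacity (pairArcs q) (inducedCut S) ≡ fromℕ (pairNodeCost q)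
      pairArcs-capacity (i , j , i≢j) = trans
        (capacity-pairGadget source sink (alt i) (pair i j i≢j) (fromℕ (N P i j)) (fromℕ (N P j i)) L
          (inducedCut S) (refl , refl) refl)
        (sym (if-float fromℕ (lookup S i)))

      altArcs-capacity : ∀ q → capacity (altArcs q) (inducedCut S) ≡ fromℕ (tieCost q)
      altArcs-capacity (i , j) = trans
        (capacity-tieGadget (alt i) (alt j) (fromℕ (E P i j)) (inducedCut S))
        (sym (if-float fromℕ (lookup S i xor lookup S j)))

      separated? : Decidable₁ (λ ((i , j) : Fin m × Fin m) → i ∈ S × j ∈ ∁ S)
      separated? (i , j) = (i ∈? S) ×-dec (j ∈? ∁ S)

      strictCost : Fin m × Fin m → ℕ
      strictCost q@(i , j) = if does (separated? q) then 2 * N P j i + E P j i else 0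

      sameCost : Fin m × Fin m → ℕ
      sameCost (i , j) = if does (lookup S i Bool.≟ lookup S j) then N P i j + N P j i else 0

      -- Grouping by unordered pairs is essential: for separated alternatives the two pair nodes
      -- contribute one `N` each, while `cost` charges both to a single ordered pair.
      unorderedPair-cost : ∀ q →
        (pairCost q + pairCost (swap q)) + tieCost q ≡ (strictCost q + strictCost (swap q)) + sameCost q
      unorderedPair-cost (i , j)
        rewrite does-∈? i S | does-∈? j S | does-∈? i (∁ S) | does-∈? j (∁ S)
              | lookup-map i not S | lookup-map j not S
        with lookup S i | lookup S j
      ... | true  | true  = trans (+-identityʳ _) (+-comm (N P j i) _)
      ... | false | false = +-identityʳ _
      -- `2 * x` unfolds to `x + (x + 0)`, hence the identity rewrite. With `i` preferred, `cost`
      -- charges `E P j i`, but the tie arc weighs `E P i j`.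
      ... | true  | false rewrite E-sym j i | +-identityʳ (N P j i) = sym (trans (+-identityʳ _) (+-identityʳ _))
      ... | false | true  rewrite +-identityʳ (N P i j) = sym (+-identityʳ _)

      ∑pairNodeCost+∑tieCost≡cost :
        ∑ pairNodeCost (distinctPairs m) + ∑ tieCost (unorderedPairs m) ≡ cost P S
      ∑pairNodeCost+∑tieCost≡cost = begin
        ∑ pairNodeCost (distinctPairs m) + ∑ tieCost (unorderedPairs m)
          ≡⟨ cong (_+ ∑ tieCost (unorderedPairs m)) (∑-distinctPairs m pairCost) ⟩
        ∑ (λ q → pairCost q + pairCost (swap q)) (unorderedPairs m) + ∑ tieCost (unorderedPairs m)
          ≡⟨ ∑-+ _ _ (unorderedPairs m) ⟨
        ∑ (λ q → (pairCost q + pairCost (swap q)) + tieCost q) (unorderedPairs m)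
          ≡⟨ ∑-cong unorderedPair-cost (unorderedPairs m) ⟩
        ∑ (λ q → (strictCost q + strictCost (swap q)) + sameCost q) (unorderedPairs m)
          ≡⟨ ∑-+ _ _ (unorderedPairs m) ⟩
        ∑ (λ q → strictCost q + strictCost (swap q)) (unorderedPairs m) + ∑ sameCost (unorderedPairs m)
          ≡⟨ cong₂ _+_
               (∑-filter-offDiagonal m _ separated? λ i (i∈S , i∈∁S) → x∈∁p⇒x∉p i∈∁S i∈S)
               (∑-filter _ _ (unorderedPairs m)) ⟨
        cost P S ∎
        where open ≡-Reasoning

      capacity-inducedCut : capacity (cutGraph P L) (inducedCut S) ≡ fromℕ (cost P S)
      capacity-inducedCut = begin
        capacity (cutGraph P L) (inducedCut S)
          ≡⟨ capacity-cutGraph (inducedCut S) ⟩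
        capacity (concatMap pairArcs (distinctPairs m)) (inducedCut S)
          +ℚ capacity (concatMap altArcs (unorderedPairs m)) (inducedCut S)
          ≡⟨ cong₂ _+ℚ_
               (capacity-concatMap-fromℕ (inducedCut S) pairArcs pairNodeCost pairArcs-capacity (distinctPairs m))
               (capacity-concatMap-fromℕ (inducedCut S) altArcs tieCost altArcs-capacity (unorderedPairs m)) ⟩
        fromℕ (∑ pairNodeCost (distinctPairs m)) +ℚ fromℕ (∑ tieCost (unorderedPairs m))
          ≡⟨ fromℕ-+ (∑ pairNodeCost (distinctPairs m)) (∑ tieCost (unorderedPairs m)) ⟨
        fromℕ (∑ pairNodeCost (distinctPairs m) + ∑ tieCost (unorderedPairs m))
          ≡⟨ cong fromℕ ∑pairNodeCost+∑tieCost≡cost ⟩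
        fromℕ (cost P S) ∎
        where open ≡-Reasoning

-- Minimum cuts against optimal orders.

mainTheorem2 : ∀ {ℓ : Level} (n m : ℕ) (P : Profile n m ℓ) (L : ℚ) → fromℕ ((m * n) ^ 5) < L →
    ((A : Partition (Node m)) → IsMinimumCut (cutGraph P L) source sink A → cost P (alternatives A) ≡ MP-2WO P)
    × ((A′ : Subset m) → cost P A′ ≡ MP-2WO P → IsMinimumCut (cutGraph P L) source sink (inducedCut A′))
mainTheorem2 n m P L L-large = minimumCut⇒optimal , optimal⇒minimumCut
  where
  open ℚ.≤-Reasoning

  -- Both directions rest on this: it reduces an arbitrary cut to an induced one, whose capacity is
  -- a cost.
  cost-alternatives-≤ : ∀ A → IsCut source sink A → fromℕ (cost P (alternatives A)) ≤ capacity (cutGraph P L) A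
  cost-alternatives-≤ A cut = subst (_≤ capacity (cutGraph P L) A)
    (capacity-inducedCut P L (alternatives A)) (capacity-induced-≤ P L L-large A cut)

  minimumCut⇒optimal : ∀ A → IsMinimumCut (cutGraph P L) source sink A → cost P (alternatives A) ≡ MP-2WO P
  -- The cut induced by an optimal order `S` is the competitor against which the minimality of `A`
  -- is used.
  minimumCut⇒optimal A (cut , minimal) with MP-2WO-attained P
  ... | S , cost-S = ℕ.≤-antisym (fromℕ-cancel-≤ (cost P (alternatives A)) (MP-2WO P) (begin
    fromℕ (cost P (alternatives A))         ≤⟨ cost-alternatives-≤ A cut ⟩
    capacity (cutGraph P L) A               ≤⟨ minimal (inducedCut S) (refl , refl) ⟩
    capacity (cutGraph P L) (inducedCut S)  ≡⟨ capacity-inducedCut P L S ⟩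
    fromℕ (cost P S)                        ≡⟨ cong fromℕ cost-S ⟩
    fromℕ (MP-2WO P)                        ∎))
    (MP-2WO-lower P (alternatives A))

  optimal⇒minimumCut : ∀ S → cost P S ≡ MP-2WO P → IsMinimumCut (cutGraph P L) source sink (inducedCut S)
  optimal⇒minimumCut S cost-S = (refl , refl) , λ A cut → begin
    capacity (cutGraph P L) (inducedCut S)  ≡⟨ capacity-inducedCut P L S ⟩
    fromℕ (cost P S)                        ≡⟨ cong fromℕ cost-S ⟩
    -- Optimality of `S` is played against the order that the competing cut `A` induces.
    fromℕ (MP-2WO P)                        ≤⟨ fromℕ-mono-≤ (MP-2WO P) (cost P (alternatives A)) (MP-2WO-lower P (alternatives A)) ⟩
    fromℕ (cost P (alternatives A))         ≤⟨ cost-alternatives-≤ A cut ⟩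
    capacity (cutGraph P L) A               ∎
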